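{- For every set $\mathbb{A}$, the homogeneous monoid $\mathcal{H}(\mathbb{A})$ over $\mathbb{A}$ is a free commutative monoid.
   Context: **Free commutative monoids.** Let $M$ be a commutative monoid. A unit of $M$ is an invertible element. A non-unit $x\in M$ is irreducible if, whenever $x=yz$ with $y,z\in M$, one of $y,z$ is a unit. Write $I(M)$ for the set of irreducible elements of $M$. For a set $X$, let $F(X)$ be the commutative monoid (under pointwise addition) of maps $\phi:X\to\mathbb{N}$ with $\{x\in X\mid \phi(x)\neq 0\}$ finite. $M$ is called free if the monoid morphism $F(I(M))\to M$, $\phi\mapsto\prod_{x\in I(M)}x^{\phi(x)}$, is an isomorphism; equivalently, every element of $M$ can be written as a product of irreducible elements in a unique way up to permutation of the factors (the empty product being the neutral element). **The homogeneous monoid.** Let $\mathbb{A}$ be any set (the alphabet), and let $\mathbb{A}^\ast$ be the set of finite words over $\mathbb{A}$, with concatenation $\ast$ and empty word $\epsilon$. For $S,S'\subseteq\mathbb{A}^\ast$ put $S\ast S'=\{w\ast w'\mid w\in S,\ w'\in S'\}$. A subset $H\subseteq\mathbb{A}^\ast$ is homogeneous if all its words have the same length $n$; this $n$ is the dimension $d(H)$ of $H$ (for $H$ nonempty). The symmetric group $\mathfrak{S}_n$ acts on words of length $n$ by $\sigma\cdot w=w\circ\sigma=(w_{\sigma(1)}\cdots w_{\sigma(n)})$, and on homogeneous sets of dimension $n$ by $\sigma\cdot H=\{\sigma\cdot w\mid w\in H\}$. Write $H\sim H'$ if $d(H)=d(H')=n$ and $H'=\sigma\cdot H$ for some $\sigma\in\mathfrak{S}_n$.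 The relation $\sim$ is a congruence for $\ast$. The homogeneous monoid $\mathcal{H}(\mathbb{A})$ is the set of $\sim$-classes of nonempty homogeneous subsets of $\mathbb{A}^\ast$ (the absorbing element $\emptyset$ being removed), with the product induced by $\ast$; it is a commutative monoid with neutral element the class of $\{\epsilon\}$. -}

module Defs where

open import Level using (Level; suc; _⊔_)
open import Algebra.Bundles using (CommutativeMonoid)
import Algebra.Definitions
import Algebra.Definitions.RawMonoid
open import Algebra.Morphism.Structures using (module MonoidMorphisms)
open import Data.Fin.Base using (Fin; splitAt; join)
open import Data.Fin.Properties using (+↔⊎; splitAt-join)
open import Data.Fin.Permutation as Perm using (Permutation; _⟨$⟩ʳ_; _∘ₚ_; inverseʳ)
open import Data.List.Base as List using (List; foldr; deduplicate)
import Data.List.Membership.Setoid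
import Data.List.Membership.Setoid.Properties as ∈ₗ
open import Data.Nat.Base as ℕ using (ℕ)
import Data.Nat.Properties as ℕ
open import Data.Product.Base using (Σ; ∃-syntax; ∃₂; _×_; _,_; proj₁; proj₂)
open import Data.Sum.Base as Sum using (_⊎_; inj₁; inj₂; [_,_]′)
open import Data.Sum.Algebra using (⊎-comm)
open import Data.Sum.Function.Propositional using (_⊎-↔_)
open import Data.Vec.Base as Vec using (Vec; []; _++_; lookup; tabulate)
open import Data.Vec.Properties
  using (tabulate-cong; tabulate∘lookup; lookup∘tabulate; lookup-splitAt; lookup-cast₁;
         ++-assoc-eqFree; ++-identityʳ-eqFree)
open import Function.Base using (_on_)
open import Function.Construct.Composition using (_↔-∘_)
open import Function.Construct.Symmetry using (↔-sym)
open import Relation.Binary.Bundles using (DecSetoid)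
open import Relation.Binary.Definitions using (Decidable)
open import Relation.Binary.PropositionalEquality
  using (_≡_; _≢_; refl; sym; trans; cong; cong₂; subst)
import Relation.Binary.Construct.On as On
open import Relation.Nullary using (¬_; yes; no)
open import Relation.Unary using (Pred; _≐_; _∈_; Satisfiable; ｛_｝)

private
  variable
    a c ℓ : Level
    m n m′ n′ k : ℕ

------------------------------------------------------------------------
-- Finitely supported functions

module _ (X : DecSetoid c ℓ) where
  open DecSetoid X using (Carrier; _≈_; setoid)
  open Data.List.Membership.Setoid setoid using () renaming (_∈_ to _∈ₗ_)

  -- `support` only has to contain the support: it may have repetitions, and
  -- elements at which the function vanishes.
  record FinSupp : Set (c ⊔ ℓ) where
    field
      fun      : Carrier → ℕ
      fun-cong : ∀ {x y} → x ≈ y → fun x ≡ fun y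
      support  : List Carrier
      covers   : ∀ {x} → fun x ≢ 0 → x ∈ₗ support

  open FinSupp

  0ᶠ : FinSupp
  0ᶠ .fun _      = 0
  0ᶠ .fun-cong _ = refl
  0ᶠ .support    = List.[]
  0ᶠ .covers 0≢0 with () ← 0≢0 refl

  _+ᶠ_ : FinSupp → FinSupp → FinSupp
  (φ +ᶠ ψ) .fun x        = fun φ x ℕ.+ fun ψ x
  (φ +ᶠ ψ) .fun-cong x≈y = cong₂ ℕ._+_ (fun-cong φ x≈y) (fun-cong ψ x≈y)
  (φ +ᶠ ψ) .support      = support φ List.++ support ψ
  (φ +ᶠ ψ) .covers {x} φ+ψ≢0 with fun φ x ℕ.≟ 0
  ... | no  φ≢0 = ∈ₗ.∈-++⁺ˡ setoid (covers φ φ≢0)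
  ... | yes φ≡0 = ∈ₗ.∈-++⁺ʳ setoid (support φ)
                    (covers ψ (λ ψ≡0 → φ+ψ≢0 (cong₂ ℕ._+_ φ≡0 ψ≡0)))

  finSupp-commutativeMonoid : CommutativeMonoid (c ⊔ ℓ) c
  finSupp-commutativeMonoid = record
    { Carrier = FinSupp
    ; _≈_     = λ φ ψ → ∀ x → fun φ x ≡ fun ψ x
    ; _∙_     = _+ᶠ_
    ; ε       = 0ᶠ
    ; isCommutativeMonoid = record
      { isMonoid = record
        { isSemigroup = record
          { isMagma = record
            { isEquivalence = record
              { refl  = λ _ → refl
              ; sym   = λ p x → sym (p x)
              ; trans = λ p q x → trans (p x) (q x)
              }
            ; ∙-cong = λ p q x → cong₂ ℕ._+_ (p x) (q x)
            }
          ; assoc = λ φ ψ χ x → ℕ.+-assoc (fun φ x) (fun ψ x) (fun χ x)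
          }
        ; identity = (λ _ _ → refl) , (λ φ x → ℕ.+-identityʳ (fun φ x))
        }
      ; comm = λ φ ψ x → ℕ.+-comm (fun φ x) (fun ψ x)
      }
    }

------------------------------------------------------------------------
-- Free commutative monoids

module _ (M : CommutativeMonoid c ℓ) where
  open CommutativeMonoid M
  open Algebra.Definitions _≈_ using (Invertible)
  open Algebra.Definitions.RawMonoid rawMonoid using () renaming (_×_ to pow)

  IsUnit : Pred Carrier (c ⊔ ℓ)
  IsUnit = Invertible ε _∙_

  record IsIrreducible (x : Carrier) : Set (c ⊔ ℓ) where
    field
      nonUnit : ¬ IsUnit x
      split   : ∀ {y z} → x ≈ y ∙ z → IsUnit y ⊎ IsUnit z

  -- Decidability of _≈_ is only used to discard repetitions from the list of
  -- factors in `irreducibleProduct`.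
  module _ (_≟_ : Decidable _≈_) where

    irreducibles : DecSetoid (c ⊔ ℓ) ℓ
    irreducibles = record
      { Carrier = Σ Carrier IsIrreducible
      ; _≈_     = _≈_ on proj₁
      ; isDecEquivalence = record
        { isEquivalence = On.isEquivalence proj₁ isEquivalence
        ; _≟_           = λ x y → proj₁ x ≟ proj₁ y
        }
      }

    irreducibleProduct : FinSupp irreducibles → Carrier
    irreducibleProduct φ =
      foldr (λ x p → pow (fun x) (proj₁ x) ∙ p) ε
            (deduplicate (DecSetoid._≟_ irreducibles) support)
      where open FinSupp φ

    IsFree : Set (c ⊔ ℓ)
    IsFree = IsMonoidIsomorphism irreducibleProduct
      where
      open MonoidMorphisms
        (CommutativeMonoid.rawMonoid (finSupp-commutativeMonoid irreducibles)) rawMonoid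

------------------------------------------------------------------------
-- Permutations acting on words

-- `Permutation m n` is inhabited only if m ≡ n; keeping the two lengths
-- syntactically distinct avoids casts.
permute : {A : Set a} → Permutation m n → Vec A n → Vec A m
permute σ w = tabulate (λ i → lookup w (σ ⟨$⟩ʳ i))

_⊕_ : Permutation m n → Permutation m′ n′ → Permutation (m ℕ.+ m′) (n ℕ.+ n′)
σ ⊕ τ = ↔-sym +↔⊎ ↔-∘ ((σ ⊎-↔ τ) ↔-∘ +↔⊎)

exchange : ∀ m n → Permutation (n ℕ.+ m) (m ℕ.+ n)
exchange m n = ↔-sym +↔⊎ ↔-∘ (⊎-comm (Fin n) (Fin m) ↔-∘ +↔⊎)

module _ {A : Set a} where

  permute-≡ : (σ : Permutation m n) (w : Vec A n) {v : Vec A m} →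
              (∀ i → lookup w (σ ⟨$⟩ʳ i) ≡ lookup v i) → permute σ w ≡ v
  permute-≡ σ w {v} eq = trans (tabulate-cong eq) (tabulate∘lookup v)

  permute-id : (w : Vec A n) → permute Perm.id w ≡ w
  permute-id w = tabulate∘lookup w

  permute-∘ : (σ : Permutation k m) (τ : Permutation m n) (w : Vec A n) →
              permute σ (permute τ w) ≡ permute (σ ∘ₚ τ) w
  permute-∘ σ τ w = tabulate-cong (λ i → lookup∘tabulate _ (σ ⟨$⟩ʳ i))

  permute-flip : (σ : Permutation m n) (w : Vec A n) →
                 permute (Perm.flip σ) (permute σ w) ≡ w
  permute-flip σ w = trans (permute-∘ (Perm.flip σ) σ w)
    (permute-≡ (Perm.flip σ ∘ₚ σ) w (λ i → cong (lookup w) (inverseʳ σ)))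

  permute-cast : .(eq : m ≡ n) (w : Vec A n) →
                 permute (Perm.cast-id eq) w ≡ Vec.cast (sym eq) w
  permute-cast eq w = permute-≡ (Perm.cast-id eq) w (λ i → sym (lookup-cast₁ (sym eq) w i))

  lookup-join : (u : Vec A m) (v : Vec A n) (s : Fin m ⊎ Fin n) →
                lookup (u ++ v) (join m n s) ≡ [ lookup u , lookup v ]′ s
  lookup-join {m} {n} u v s =
    trans (lookup-splitAt m u v (join m n s))
          (cong [ lookup u , lookup v ]′ (splitAt-join m n s))

  permute-⊕ : (σ : Permutation m n) (τ : Permutation m′ n′) (u : Vec A n) (v : Vec A n′) →
              permute (σ ⊕ τ) (u ++ v) ≡ permute σ u ++ permute τ v
  permute-⊕ {m = m} σ τ u v = permute-≡ (σ ⊕ τ) (u ++ v) λ i →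
    trans (lookup-join u v (Sum.map (σ ⟨$⟩ʳ_) (τ ⟨$⟩ʳ_) (splitAt m i)))
          (trans (pointwise (splitAt m i))
                 (sym (lookup-splitAt m (permute σ u) (permute τ v) i)))
    where
    pointwise : ∀ s → [ lookup u , lookup v ]′ (Sum.map (σ ⟨$⟩ʳ_) (τ ⟨$⟩ʳ_) s)
                      ≡ [ lookup (permute σ u) , lookup (permute τ v) ]′ s
    pointwise (inj₁ i) = sym (lookup∘tabulate _ i)
    pointwise (inj₂ i) = sym (lookup∘tabulate _ i)

  permute-exchange : (u : Vec A m) (v : Vec A n) →
                     permute (exchange m n) (u ++ v) ≡ v ++ u
  permute-exchange {m} {n} u v = permute-≡ (exchange m n) (u ++ v) λ i →
    trans (lookup-join u v (Sum.swap (splitAt n i)))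
          (trans (pointwise (splitAt n i)) (sym (lookup-splitAt n v u i)))
    where
    pointwise : ∀ s → [ lookup u , lookup v ]′ (Sum.swap s) ≡ [ lookup v , lookup u ]′ s
    pointwise (inj₁ i) = refl
    pointwise (inj₂ i) = refl

------------------------------------------------------------------------
-- The homogeneous monoid

module _ {A : Set a} where

  infixl 7 _∗_
  infixr 8 _·_

  _∗_ : Pred (Vec A m) a → Pred (Vec A n) a → Pred (Vec A (m ℕ.+ n)) a
  (S ∗ T) v = ∃₂ λ u w → u ∈ S × w ∈ T × v ≡ u ++ w

  _·_ : Permutation m n → Pred (Vec A n) a → Pred (Vec A m) a
  (σ · S) v = ∃[ w ] w ∈ S × v ≡ permute σ w

module _ (A : Set a) where

  record Homogeneous : Set (suc a) where
    constructor homogeneous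
    field
      {dim}    : ℕ
      words    : Pred (Vec A dim) a
      nonempty : Satisfiable words

module _ {A : Set a} where

  open Homogeneous

  infix 4 _∼_
  infixl 7 _⊛_

  -- The equality of dimensions is implied, see `∼⇒dim≡`.
  _∼_ : Homogeneous A → Homogeneous A → Set a
  H ∼ H′ = ∃[ σ ] words H′ ≐ σ · words H

  ∼⇒dim≡ : ∀ H H′ → H ∼ H′ → dim H ≡ dim H′
  ∼⇒dim≡ H H′ (σ , _) = sym (Perm.↔⇒≡ σ)

  _⊛_ : Homogeneous A → Homogeneous A → Homogeneous A
  homogeneous S (u , u∈S) ⊛ homogeneous T (w , w∈T) =
    homogeneous (S ∗ T) (u ++ w , u , w , u∈S , w∈T , refl)

  𝟙 : Homogeneous A
  𝟙 = homogeneous ｛ [] ｝ ([] , refl)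

  ∼-refl : ∀ {H} → H ∼ H
  ∼-refl {H} = Perm.id
    , (λ {w} w∈H → w , w∈H , sym (permute-id w))
    , λ { (w , w∈H , refl) → subst (words H) (sym (permute-id w)) w∈H }

  ∼-sym : ∀ {H H′} → H ∼ H′ → H′ ∼ H
  ∼-sym {H} (σ , H′⊆σH , σH⊆H′) = Perm.flip σ
    , (λ {w} w∈H → permute σ w , σH⊆H′ (w , w∈H , refl) , sym (permute-flip σ w))
    , λ { (v , v∈H′ , refl) → back (H′⊆σH v∈H′) }
    where
    back : ∀ {v} → v ∈ σ · words H → permute (Perm.flip σ) v ∈ words H
    back (w , w∈H , refl) = subst (words H) (sym (permute-flip σ w)) w∈H

  ∼-trans : ∀ {H H′ H″} → H ∼ H′ → H′ ∼ H″ → H ∼ H″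
  ∼-trans {H} {H′} {H″} (σ , H′⊆σH , σH⊆H′) (τ , H″⊆τH′ , τH′⊆H″) = τ ∘ₚ σ
    , (λ v∈H″ → there (H″⊆τH′ v∈H″))
    , λ { (w , w∈H , refl) →
            τH′⊆H″ (permute σ w , σH⊆H′ (w , w∈H , refl) , sym (permute-∘ τ σ w)) }
    where
    there : ∀ {v} → v ∈ τ · words H′ → v ∈ (τ ∘ₚ σ) · words H
    there (u , u∈H′ , refl) with H′⊆σH u∈H′
    ... | w , w∈H , refl = w , w∈H , permute-∘ τ σ w

  ⊛-cong : ∀ {H H′ K K′} → H ∼ H′ → K ∼ K′ → H ⊛ K ∼ H′ ⊛ K′
  ⊛-cong {H} {H′} {K} {K′} (σ , H′⊆σH , σH⊆H′) (τ , K′⊆τK , τK⊆K′) = σ ⊕ τ , to , from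
    where
    to : ∀ {v} → v ∈ words H′ ∗ words K′ → v ∈ (σ ⊕ τ) · (words H ∗ words K)
    to (_ , _ , p , q , refl) with H′⊆σH p | K′⊆τK q
    ... | u , u∈H , refl | w , w∈K , refl =
      u ++ w , (u , w , u∈H , w∈K , refl) , sym (permute-⊕ σ τ u w)
    from : ∀ {v} → v ∈ (σ ⊕ τ) · (words H ∗ words K) → v ∈ words H′ ∗ words K′
    from (_ , (u , w , u∈H , w∈K , refl) , refl) =
      permute σ u , permute τ w , σH⊆H′ (u , u∈H , refl) , τK⊆K′ (w , w∈K , refl)
      , permute-⊕ σ τ u w

  ⊛-assoc : ∀ H K L → (H ⊛ K) ⊛ L ∼ H ⊛ (K ⊛ L)
  ⊛-assoc H K L = ρ , to , from
    where
    eq : dim H ℕ.+ dim K ℕ.+ dim L ≡ dim H ℕ.+ (dim K ℕ.+ dim L)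
    eq = ℕ.+-assoc (dim H) (dim K) (dim L)
    ρ = Perm.cast-id (sym eq)
    reassoc : ∀ u v w → permute ρ ((u ++ v) ++ w) ≡ u ++ (v ++ w)
    reassoc u v w = trans (permute-cast (sym eq) ((u ++ v) ++ w)) (++-assoc-eqFree u v w)
    to : ∀ {x} → x ∈ words (H ⊛ (K ⊛ L)) → x ∈ ρ · words ((H ⊛ K) ⊛ L)
    to (u , _ , u∈H , (v , w , v∈K , w∈L , refl) , refl) =
      (u ++ v) ++ w , (u ++ v , w , (u , v , u∈H , v∈K , refl) , w∈L , refl)
      , sym (reassoc u v w)
    from : ∀ {x} → x ∈ ρ · words ((H ⊛ K) ⊛ L) → x ∈ words (H ⊛ (K ⊛ L))
    from (_ , (_ , w , (u , v , u∈H , v∈K , refl) , w∈L , refl) , refl) =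
      u , v ++ w , u∈H , (v , w , v∈K , w∈L , refl) , reassoc u v w

  ⊛-comm : ∀ H K → H ⊛ K ∼ K ⊛ H
  ⊛-comm H K = exchange (dim H) (dim K)
    , (λ { (v , u , v∈K , u∈H , refl) →
             u ++ v , (u , v , u∈H , v∈K , refl) , sym (permute-exchange u v) })
    , λ { (_ , (u , v , u∈H , v∈K , refl) , refl) →
             v , u , v∈K , u∈H , permute-exchange u v }

  ⊛-identityˡ : ∀ H → 𝟙 ⊛ H ∼ H
  ⊛-identityˡ H = Perm.id
    , (λ {w} w∈H → w , ([] , w , refl , w∈H , refl) , sym (permute-id w))
    , λ { (_ , ([] , w , refl , w∈H , refl) , refl) →
            subst (words H) (sym (permute-id w)) w∈H }

  ⊛-identityʳ : ∀ H → H ⊛ 𝟙 ∼ H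
  ⊛-identityʳ H = ∼-trans {H ⊛ 𝟙} {𝟙 ⊛ H} {H} (⊛-comm H 𝟙) (⊛-identityˡ H)

homogeneousMonoid : Set a → CommutativeMonoid (suc a) a
homogeneousMonoid A = record
  { Carrier = Homogeneous A
  ; _≈_     = _∼_
  ; _∙_     = _⊛_
  ; ε       = 𝟙
  ; isCommutativeMonoid = record
    { isMonoid = record
      { isSemigroup = record
        { isMagma = record
          { isEquivalence = record
            { refl  = λ {H} → ∼-refl {H = H}
            ; sym   = λ {H} {K} → ∼-sym {H = H} {K}
            ; trans = λ {H} {K} {L} → ∼-trans {H = H} {K} {L}
            }
          ; ∙-cong = λ {H} {H′} {K} {K′} → ⊛-cong {H = H} {H′} {K} {K′}
          }
        ; assoc = ⊛-assoc
        }
      ; identity = ⊛-identityˡ , ⊛-identityʳ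
      }
    ; comm = ⊛-comm
    }
  }

-- A factorization of a homogeneous set H is a splitting of the positions into two blocks such that
-- recombining the first block of one word of H with the second block of another stays in H.  Two
-- such splittings have a common refinement into four blocks, so if p ∙ q ≈ r ∙ s then p ≈ x ∙ y,
-- q ≈ z ∙ w, r ≈ x ∙ z and s ≈ y ∙ w for some x, y, z, w.  In a monoid with this refinement property
-- and no non-trivial units, two factorizations of an element into irreducibles agree up to order,
-- even without assuming cancellation.  Existence of factorizations is by induction on the dimension.

module Submission where

open import Defs
open import Algebra.Bundles using (CommutativeMonoid)
import Algebra.Definitions.RawMonoid
import Algebra.Properties.CommutativeSemigroup
open import Axiom.ExcludedMiddle using (ExcludedMiddle)
open import Data.Fin.Base using (Fin; zero; suc; splitAt; join)
open import Data.Fin.Permutation as Perm using (Permutation; _⟨$⟩ʳ_; _∘ₚ_; inverseʳ; ↔⇒≡)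
open import Data.Fin.Properties using (+↔⊎; join-splitAt)
open import Data.List.Base using (List; []; _∷_; length; replicate; foldr; deduplicate)
  renaming (_++_ to _++ₗ_)
import Data.List.Membership.DecSetoid
import Data.List.Membership.Setoid.Properties as ∈ₗ
open import Data.List.Relation.Unary.Any using (here; there)
open import Data.List.Relation.Unary.AllPairs using (_∷_)
import Data.List.Relation.Unary.Unique.Setoid
open import Data.List.Relation.Unary.Unique.DecSetoid.Properties using (deduplicate-!)
open import Data.Nat.Base using (ℕ; zero; suc; _+_; _≤_; s≤s; s≤s⁻¹)
import Data.Nat.Properties as ℕ
open import Data.Product.Base using (Σ; ∃-syntax; ∃₂; _×_; _,_; proj₁; proj₂)
open import Data.Sum.Algebra using (⊎-comm)
open import Data.Sum.Base as Sum using (_⊎_; inj₁; inj₂; [_,_]′)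
open import Data.Sum.Function.Propositional using (_⊎-↔_)
open import Data.Sum.Properties using (inj₁-injective; map-map)
open import Data.Vec.Base using (Vec; []; _++_; lookup) renaming (splitAt to splitAtᵛ)
open import Data.Vec.Properties using (tabulate-cong; ++-injective)
open import Function.Base using (_∘_; id)
open import Function.Bundles using (_↔_; Inverse; mk↔ₛ′; mk⤖; module Injection)
open import Function.Construct.Composition using (_↔-∘_)
open import Function.Construct.Symmetry using (↔-sym)
open import Function.Properties.Bijection using (⤖⇒↔)
open import Function.Properties.Inverse using (↔⇒↣)
open import Level using (Level; _⊔_)
open import Relation.Binary.Bundles using (DecSetoid)
open import Relation.Binary.Definitions using (Decidable)
open import Relation.Binary.PropositionalEquality as ≡ using (_≡_; _≢_; module ≡-Reasoning)
import Relation.Binary.Reasoning.Setoid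
open import Relation.Nullary using (¬_; yes; no; contradiction)
open import Relation.Unary using (Pred; Satisfiable; _∈_)

private
  variable
    a b c d ℓ : Level
    A B C D : Set a
    k l m n : ℕ

-- Lists counted with multiplicity, as models of finitely supported functions.

module Multiplicity (X : DecSetoid c ℓ) where
  open DecSetoid X
  open Data.List.Membership.DecSetoid X using (_∉_; _∈?_) renaming (_∈_ to _∈ₗ_)
  open Data.List.Relation.Unary.Unique.Setoid setoid using (Unique)

  indicator : Carrier → Carrier → ℕ
  indicator z x with z ≟ x
  ... | yes _ = 1
  ... | no  _ = 0

  indicator-yes : ∀ {z x} → z ≈ x → indicator z x ≡ 1
  indicator-yes {z} {x} z≈x with z ≟ x
  ... | yes _   = ≡.refl
  ... | no  z≉x = contradiction z≈x z≉x

  indicator-no : ∀ {z x} → ¬ z ≈ x → indicator z x ≡ 0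
  indicator-no {z} {x} z≉x with z ≟ x
  ... | yes z≈x = contradiction z≈x z≉x
  ... | no  _   = ≡.refl

  indicator-cong : ∀ {z z′ x x′} → z ≈ z′ → x ≈ x′ → indicator z x ≡ indicator z′ x′
  indicator-cong {z} {z′} {x} {x′} z≈z′ x≈x′ with z ≟ x
  ... | yes z≈x = ≡.sym (indicator-yes (trans (sym z≈z′) (trans z≈x x≈x′)))
  ... | no  z≉x = ≡.sym (indicator-no (λ z′≈x′ → z≉x (trans z≈z′ (trans z′≈x′ (sym x≈x′)))))

  multiplicity : Carrier → List Carrier → ℕ
  multiplicity z []       = 0
  multiplicity z (x ∷ xs) = indicator z x + multiplicity z xs

  multiplicity-cong : ∀ {z z′} xs → z ≈ z′ → multiplicity z xs ≡ multiplicity z′ xs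
  multiplicity-cong []       z≈z′ = ≡.refl
  multiplicity-cong (x ∷ xs) z≈z′ = ≡.cong₂ _+_ (indicator-cong z≈z′ refl) (multiplicity-cong xs z≈z′)

  multiplicity-++ : ∀ z xs ys → multiplicity z (xs ++ₗ ys) ≡ multiplicity z xs + multiplicity z ys
  multiplicity-++ z []       ys = ≡.refl
  multiplicity-++ z (x ∷ xs) ys =
    ≡.trans (≡.cong (indicator z x +_) (multiplicity-++ z xs ys)) (≡.sym (ℕ.+-assoc (indicator z x) _ _))

  multiplicity≢0⇒∈ : ∀ {z} xs → multiplicity z xs ≢ 0 → z ∈ₗ xs
  multiplicity≢0⇒∈     []       ≢0 = contradiction ≡.refl ≢0
  multiplicity≢0⇒∈ {z} (x ∷ xs) ≢0 with z ≟ x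
  ... | yes z≈x = here z≈x
  ... | no  _   = there (multiplicity≢0⇒∈ xs ≢0)

  multiplicity-head≢0 : ∀ x xs → multiplicity x (x ∷ xs) ≢ 0
  multiplicity-head≢0 x xs ≡0
    with () ← ≡.trans (≡.cong (_+ multiplicity x xs) (≡.sym (indicator-yes refl))) ≡0

  multiplicity-replicate-yes : ∀ {z x} n → z ≈ x → multiplicity z (replicate n x) ≡ n
  multiplicity-replicate-yes zero    z≈x = ≡.refl
  multiplicity-replicate-yes (suc n) z≈x = ≡.cong₂ _+_ (indicator-yes z≈x) (multiplicity-replicate-yes n z≈x)

  multiplicity-replicate-no : ∀ {z x} n → ¬ z ≈ x → multiplicity z (replicate n x) ≡ 0
  multiplicity-replicate-no zero    z≉x = ≡.refl
  multiplicity-replicate-no (suc n) z≉x = ≡.cong₂ _+_ (indicator-no z≉x) (multiplicity-replicate-no n z≉x)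

  open FinSupp

  expandOver : FinSupp X → List Carrier → List Carrier
  expandOver φ = foldr (λ x xs → replicate (fun φ x) x ++ₗ xs) []

  multiplicity-expandOver-∉ : ∀ φ {z} ds → z ∉ ds → multiplicity z (expandOver φ ds) ≡ 0
  multiplicity-expandOver-∉ φ     []       z∉ds = ≡.refl
  multiplicity-expandOver-∉ φ {z} (d ∷ ds) z∉ds =
    ≡.trans (multiplicity-++ z (replicate (fun φ d) d) _)
      (≡.cong₂ _+_ (multiplicity-replicate-no (fun φ d) (z∉ds ∘ here))
                   (multiplicity-expandOver-∉ φ ds (z∉ds ∘ there)))

  multiplicity-expandOver-∈ : ∀ φ {z} {ds} → Unique ds → z ∈ₗ ds →
                              multiplicity z (expandOver φ ds) ≡ fun φ z
  multiplicity-expandOver-∈ φ {z} {d ∷ ds} (d∉ds ∷ _) (here z≈d) =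
    ≡.trans (multiplicity-++ z (replicate (fun φ d) d) _)
      (≡.trans (≡.cong₂ _+_
        (≡.trans (multiplicity-replicate-yes (fun φ d) z≈d) (fun-cong φ (sym z≈d)))
        (multiplicity-expandOver-∉ φ ds (∈ₗ.∉-resp-≈ setoid (sym z≈d) (∈ₗ.All[≉]⇒∉ setoid d∉ds))))
        (ℕ.+-identityʳ _))
  multiplicity-expandOver-∈ φ {z} {d ∷ ds} (d∉ds ∷ uniq) (there z∈ds) =
    ≡.trans (multiplicity-++ z (replicate (fun φ d) d) _)
      (≡.cong₂ _+_
        (multiplicity-replicate-no (fun φ d)
          (λ z≈d → ∈ₗ.∉-resp-≈ setoid (sym z≈d) (∈ₗ.All[≉]⇒∉ setoid d∉ds) z∈ds))
        (multiplicity-expandOver-∈ φ uniq z∈ds))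

  -- `support` may repeat elements, so it is deduplicated before each element is copied. The same
  -- deduplication occurs in `irreducibleProduct`, which lets the two products be compared entry by
  -- entry.
  expand : FinSupp X → List Carrier
  expand φ = expandOver φ (deduplicate _≟_ (support φ))

  multiplicity-expand : ∀ φ z → multiplicity z (expand φ) ≡ fun φ z
  multiplicity-expand φ z with fun φ z ℕ.≟ 0 | z ∈? deduplicate _≟_ (support φ)
  ... | _       | yes z∈ds = multiplicity-expandOver-∈ φ (deduplicate-! X (support φ)) z∈ds
  ... | yes φ≡0 | no  z∉ds = ≡.trans (multiplicity-expandOver-∉ φ _ z∉ds) (≡.sym φ≡0)
  -- A nonzero value forces membership in `support` by `covers`, and deduplication keeps a
  -- representative.
  ... | no  φ≢0 | no  z∉ds = contradiction
    (∈ₗ.∈-deduplicate⁺ setoid _≟_ (λ x≈y z≈y → trans z≈y (sym x≈y)) (covers φ φ≢0)) z∉ds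

  fromList : List Carrier → FinSupp X
  fromList xs .fun z    = multiplicity z xs
  fromList xs .fun-cong = multiplicity-cong xs
  fromList xs .support  = xs
  fromList xs .covers   = multiplicity≢0⇒∈ xs

-- Conical monoids and the Riesz refinement property.

module _ (M : CommutativeMonoid c ℓ) where
  open CommutativeMonoid M

  Conical : Set (c ⊔ ℓ)
  Conical = ∀ {x y} → x ∙ y ≈ ε → x ≈ ε

  -- The four elements form a two-by-two matrix with row products `p`, `q` and column products `r`,
  -- `s`.
  RefinementProperty : Set (c ⊔ ℓ)
  RefinementProperty = ∀ {p q r s} → p ∙ q ≈ r ∙ s → ∃₂ λ x y → ∃₂ λ z w →
                       (p ≈ x ∙ y × q ≈ z ∙ w) × (r ≈ x ∙ z × s ≈ y ∙ w)

  conical⇒unit≈ε : Conical → ∀ x → IsUnit M x → x ≈ ε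
  conical⇒unit≈ε conical x (_ , _ , x∙x⁻¹≈ε) = conical x∙x⁻¹≈ε

  ≈ε⇒unit : ∀ x → x ≈ ε → IsUnit M x
  ≈ε⇒unit x x≈ε = ε , trans (identityˡ _) x≈ε , trans (identityʳ _) x≈ε

-- Freeness of atomic conical refinement monoids.

module IrreducibleFactorization
  (M : CommutativeMonoid c ℓ) (_≟_ : Decidable (CommutativeMonoid._≈_ M)) where

  open CommutativeMonoid M
  open Algebra.Definitions.RawMonoid rawMonoid using () renaming (_×_ to pow)
  open Algebra.Properties.CommutativeSemigroup commutativeSemigroup using (x∙yz≈y∙xz)
  open Relation.Binary.Reasoning.Setoid setoid
  open FinSupp

  private
    X = irreducibles M _≟_

  open Multiplicity X
  open Algebra.Properties.CommutativeSemigroup ℕ.+-commutativeSemigroup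
    using () renaming (x∙yz≈y∙xz to +-exchange)

  Irreducible : Set (c ⊔ ℓ)
  Irreducible = DecSetoid.Carrier X

  product : List Irreducible → Carrier
  product = foldr (λ x p → proj₁ x ∙ p) ε

  product-++ : ∀ xs ys → product (xs ++ₗ ys) ≈ product xs ∙ product ys
  product-++ []       ys = sym (identityˡ _)
  product-++ (x ∷ xs) ys = trans (∙-congˡ (product-++ xs ys)) (sym (assoc _ _ _))

  product-replicate : ∀ n x → product (replicate n x) ≈ pow n (proj₁ x)
  product-replicate zero    x = refl
  product-replicate (suc n) x = ∙-congˡ (product-replicate n x)

  product-expandOver : ∀ φ ds → product (expandOver φ ds) ≈
                       foldr (λ x p → pow (fun φ x) (proj₁ x) ∙ p) ε ds
  product-expandOver φ []       = refl
  product-expandOver φ (d ∷ ds) =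
    trans (product-++ (replicate (fun φ d) d) _)
          (∙-cong (product-replicate (fun φ d) d) (product-expandOver φ ds))

  -- Commutativity brings an occurrence of `x` to the front, so an induction on one list can strip
  -- the matching factor from the other.
  remove : ∀ {x} ys → multiplicity x ys ≢ 0 →
           ∃[ ys′ ] product ys ≈ proj₁ x ∙ product ys′ ×
                    (∀ z → multiplicity z ys ≡ multiplicity z (x ∷ ys′))
  remove     []       ≢0 = contradiction ≡.refl ≢0
  remove {x} (y ∷ ys) ≢0 with proj₁ x ≟ proj₁ y
  ... | yes x≈y = ys , ∙-congʳ (sym x≈y)
                , λ z → ≡.cong (_+ _) (indicator-cong {z} {z} {y} {x} refl (sym x≈y))
  ... | no  _   with remove {x} ys ≢0
  ...   | ys′ , eq , mults = y ∷ ys′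
    , trans (∙-congˡ eq) (x∙yz≈y∙xz _ _ _)
    , λ z → ≡.trans (≡.cong (indicator z y +_) (mults z))
                    (+-exchange (indicator z y) (indicator z x) (multiplicity z ys′))

  -- Invariance of the product under reordering, obtained without constructing a permutation. The
  -- cancellation takes place among the multiplicities in `ℕ`, not in the monoid.
  multiplicity≡⇒product≈ : ∀ xs ys → (∀ z → multiplicity z xs ≡ multiplicity z ys) →
                           product xs ≈ product ys
  multiplicity≡⇒product≈ []       []       eq = refl
  multiplicity≡⇒product≈ []       (y ∷ ys) eq =
    contradiction (≡.sym (eq y)) (multiplicity-head≢0 y ys)
  multiplicity≡⇒product≈ (x ∷ xs) ys       eq
    with ys′ , ys≈ , mults ← remove {x} ys (λ ≡0 → multiplicity-head≢0 x xs (≡.trans (eq x) ≡0)) =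
    trans (∙-congˡ (multiplicity≡⇒product≈ xs ys′
            (λ z → ℕ.+-cancelˡ-≡ (indicator z x) _ _ (≡.trans (eq z) (mults z)))))
          (sym ys≈)

  module _ (conical : Conical M) (refinement : RefinementProperty M)
           (atomic : ∀ x → ∃[ xs ] x ≈ product xs) where

    irreducible-≉ε : (x : Irreducible) → ¬ proj₁ x ≈ ε
    irreducible-≉ε (_ , irr) = IsIrreducible.nonUnit irr ∘ ≈ε⇒unit M _

    irreducible-split : (p : Irreducible) → ∀ {x y} → proj₁ p ≈ x ∙ y → x ≈ ε ⊎ y ≈ ε
    irreducible-split (_ , irr) eq with IsIrreducible.split irr eq
    ... | inj₁ u = inj₁ (conical⇒unit≈ε M conical _ u)
    ... | inj₂ u = inj₂ (conical⇒unit≈ε M conical _ u)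

    ≈-dropˡ : ∀ {p x y} → x ≈ ε → p ≈ x ∙ y → p ≈ y
    ≈-dropˡ x≈ε p≈ = trans p≈ (trans (∙-congʳ x≈ε) (identityˡ _))

    ≈-dropʳ : ∀ {p x y} → y ≈ ε → p ≈ x ∙ y → p ≈ x
    ≈-dropʳ y≈ε p≈ = trans p≈ (trans (∙-congˡ y≈ε) (identityʳ _))

    -- If p and q land in different blocks, then ps and qs have the common part w: with W a list of
    -- irreducible factors of w, ps is q ∷ W and qs is p ∷ W up to order.  The equality of lengths is
    -- proved along with the multiplicities because p ∷ W must be known to be shorter than p ∷ ps.
    product-injective : ∀ n ps qs → length ps ≡ n → product ps ≈ product qs →
                        length ps ≡ length qs × (∀ z → multiplicity z ps ≡ multiplicity z qs)
    product-injective n []       []       _ _  = ≡.refl , λ _ → ≡.refl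
    product-injective n []       (q ∷ qs) _ eq = contradiction (conical (sym eq)) (irreducible-≉ε q)
    product-injective n (p ∷ ps) []       _ eq = contradiction (conical eq) (irreducible-≉ε p)
    product-injective (suc n) (p ∷ ps) (q ∷ qs) len eq
      with x , y , z , w , (p≈ , P≈) , (q≈ , Q≈) ← refinement eq
      with irreducible-split p p≈ | irreducible-split q q≈
    ... | inj₁ x≈ε | inj₁ _   = shared
      where
      W = proj₁ (atomic w)
      w≈ : w ≈ product W
      w≈ = proj₂ (atomic w)
      ps~ : length ps ≡ length (q ∷ W) × (∀ v → multiplicity v ps ≡ multiplicity v (q ∷ W))
      ps~ = product-injective n ps (q ∷ W) (ℕ.suc-injective len)
              (trans P≈ (∙-cong (sym (≈-dropˡ x≈ε q≈)) w≈))
      qs~ : length (p ∷ W) ≡ length qs × (∀ v → multiplicity v (p ∷ W) ≡ multiplicity v qs)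
      qs~ = product-injective n (p ∷ W) qs
              (≡.trans (≡.sym (proj₁ ps~)) (ℕ.suc-injective len))
              (sym (trans Q≈ (∙-cong (sym (≈-dropˡ x≈ε p≈)) w≈)))
      shared : length (p ∷ ps) ≡ length (q ∷ qs) ×
               (∀ z → multiplicity z (p ∷ ps) ≡ multiplicity z (q ∷ qs))
      shared = ≡.cong suc (≡.trans (proj₁ ps~) (proj₁ qs~))
             , λ v → ≡.trans (≡.cong (indicator v p +_) (proj₂ ps~ v))
                     (≡.trans (+-exchange (indicator v p) (indicator v q) (multiplicity v W))
                              (≡.cong (indicator v q +_) (proj₂ qs~ v)))
    ... | inj₁ x≈ε | inj₂ z≈ε = contradiction (trans (≈-dropʳ z≈ε q≈) x≈ε) (irreducible-≉ε q)
    ... | inj₂ y≈ε | inj₁ x≈ε = contradiction (trans (≈-dropʳ y≈ε p≈) x≈ε) (irreducible-≉ε p)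
    ... | inj₂ y≈ε | inj₂ z≈ε
      with lengths , mults ← product-injective n ps qs (ℕ.suc-injective len)
             (trans (≈-dropˡ z≈ε P≈) (sym (≈-dropˡ y≈ε Q≈))) =
      ≡.cong suc lengths
      , λ v → ≡.cong₂ _+_
          (indicator-cong {v} {v} {p} {q} refl
            (trans (≈-dropʳ y≈ε p≈) (sym (≈-dropʳ z≈ε q≈))))
          (mults v)

    isFree : IsFree M _≟_
    isFree = record
      { isMonoidMonomorphism = record
        { isMonoidHomomorphism = record
          { isMagmaHomomorphism = record
            { isRelHomomorphism = record { cong = λ {φ} {ψ} → ⟦⟧-cong φ ψ }
            ; homo = ⟦⟧-homo
            }
          ; ε-homo = refl
          }
        ; injective = λ {φ} {ψ} → ⟦⟧-injective φ ψ
        }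
      ; surjective = ⟦⟧-surjective
      }
      where
      ⟦_⟧ : FinSupp X → Carrier
      ⟦_⟧ = irreducibleProduct M _≟_

      ⟦⟧-expand : ∀ φ → product (expand φ) ≈ ⟦ φ ⟧
      ⟦⟧-expand φ = product-expandOver φ (deduplicate (DecSetoid._≟_ X) (support φ))

      -- Any list with the right multiplicities computes `⟦ φ ⟧`. Congruence, the homomorphism law
      -- and surjectivity then follow by choosing a convenient list.
      ⟦⟧-≈product : ∀ φ xs → (∀ z → fun φ z ≡ multiplicity z xs) → ⟦ φ ⟧ ≈ product xs
      ⟦⟧-≈product φ xs eq = trans (sym (⟦⟧-expand φ))
        (multiplicity≡⇒product≈ (expand φ) xs (λ z → ≡.trans (multiplicity-expand φ z) (eq z)))

      ⟦⟧-cong : ∀ φ ψ → (∀ z → fun φ z ≡ fun ψ z) → ⟦ φ ⟧ ≈ ⟦ ψ ⟧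
      ⟦⟧-cong φ ψ eq = trans
        (⟦⟧-≈product φ (expand ψ) (λ z → ≡.trans (eq z) (≡.sym (multiplicity-expand ψ z))))
        (⟦⟧-expand ψ)

      ⟦⟧-homo : ∀ φ ψ → ⟦ _+ᶠ_ X φ ψ ⟧ ≈ ⟦ φ ⟧ ∙ ⟦ ψ ⟧
      ⟦⟧-homo φ ψ = begin
        ⟦ _+ᶠ_ X φ ψ ⟧
          ≈⟨ ⟦⟧-≈product (_+ᶠ_ X φ ψ) (expand φ ++ₗ expand ψ) sums ⟩
        product (expand φ ++ₗ expand ψ)         ≈⟨ product-++ (expand φ) (expand ψ) ⟩
        product (expand φ) ∙ product (expand ψ) ≈⟨ ∙-cong (⟦⟧-expand φ) (⟦⟧-expand ψ) ⟩
        ⟦ φ ⟧ ∙ ⟦ ψ ⟧                           ∎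
        where
        sums : ∀ z → fun φ z + fun ψ z ≡ multiplicity z (expand φ ++ₗ expand ψ)
        sums z = ≡.sym (≡.trans (multiplicity-++ z (expand φ) (expand ψ))
          (≡.cong₂ _+_ (multiplicity-expand φ z) (multiplicity-expand ψ z)))

      ⟦⟧-injective : ∀ φ ψ → ⟦ φ ⟧ ≈ ⟦ ψ ⟧ → ∀ z → fun φ z ≡ fun ψ z
      ⟦⟧-injective φ ψ eq z = ≡.trans (≡.sym (multiplicity-expand φ z)) (≡.trans
        (proj₂ (product-injective _ (expand φ) (expand ψ) ≡.refl
          (trans (⟦⟧-expand φ) (trans eq (sym (⟦⟧-expand ψ))))) z)
        (multiplicity-expand ψ z))

      ⟦⟧-surjective : ∀ y → ∃[ φ ] (∀ {ψ} → (∀ z → fun ψ z ≡ fun φ z) → ⟦ ψ ⟧ ≈ y)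
      ⟦⟧-surjective y with xs , y≈ ← atomic y =
        fromList xs , λ {ψ} eq → trans (⟦⟧-≈product ψ xs eq) (sym y≈)

-- Bijections between disjoint unions, and sorting of finite sets into two blocks.

open ≡ using (refl; sym; trans; cong; cong₂)
open Inverse using (to; from; strictlyInverseˡ; strictlyInverseʳ)

interchange : (A ⊎ B) ⊎ (C ⊎ D) → (A ⊎ C) ⊎ (B ⊎ D)
interchange (inj₁ (inj₁ x)) = inj₁ (inj₁ x)
interchange (inj₁ (inj₂ x)) = inj₂ (inj₁ x)
interchange (inj₂ (inj₁ x)) = inj₁ (inj₂ x)
interchange (inj₂ (inj₂ x)) = inj₂ (inj₂ x)

interchange-involutive : (s : (A ⊎ B) ⊎ (C ⊎ D)) → interchange (interchange s) ≡ s
interchange-involutive (inj₁ (inj₁ x)) = refl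
interchange-involutive (inj₁ (inj₂ x)) = refl
interchange-involutive (inj₂ (inj₁ x)) = refl
interchange-involutive (inj₂ (inj₂ x)) = refl

interchange-↔ : ((A ⊎ B) ⊎ (C ⊎ D)) ↔ ((A ⊎ C) ⊎ (B ⊎ D))
interchange-↔ = mk↔ₛ′ interchange interchange interchange-involutive interchange-involutive

to-injective : (f : A ↔ B) {x y : A} → to f x ≡ to f y → x ≡ y
to-injective f = Injection.injective (↔⇒↣ f)

module _ (ρ : (A ⊎ B) ↔ (C ⊎ D)) {f : A → C} {g : B → D} (ρ≗ : ∀ s → to ρ s ≡ Sum.map f g s) where

  -- Injectivity is inherited from `ρ`. For surjectivity, the preimage of `inj₁ y` cannot lie in
  -- `B`, because `ρ` sends that summand into `D`.
  ↔-restrict₁ : A ↔ C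
  ↔-restrict₁ = ⤖⇒↔ (mk⤖ (injective , surjective))
    where
    injective : ∀ {x y} → f x ≡ f y → x ≡ y
    injective {x} {y} eq = inj₁-injective (to-injective ρ
      (trans (ρ≗ (inj₁ x)) (trans (cong inj₁ eq) (sym (ρ≗ (inj₁ y))))))
    surjective : ∀ y → ∃[ x ] (∀ {z} → z ≡ x → f z ≡ y)
    surjective y with from ρ (inj₁ y) in eq
    ... | inj₁ x = x , λ { refl → inj₁-injective
      (trans (sym (ρ≗ (inj₁ x))) (trans (cong (to ρ) (sym eq)) (strictlyInverseˡ ρ (inj₁ y)))) }
    ... | inj₂ x with () ←
      trans (sym (ρ≗ (inj₂ x))) (trans (cong (to ρ) (sym eq)) (strictlyInverseˡ ρ (inj₁ y)))

module _ (ρ : (A ⊎ B) ↔ (C ⊎ D)) {f : A → C} {g : B → D} (ρ≗ : ∀ s → to ρ s ≡ Sum.map f g s) where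

  -- Conjugating `ρ` by the swaps of both unions exchanges the roles of the summands.
  ↔-restrict₂ : B ↔ D
  ↔-restrict₂ = ↔-restrict₁ (⊎-comm _ _ ↔-∘ (ρ ↔-∘ ⊎-comm _ _)) {g} {f} λ
    { (inj₁ x) → cong Sum.swap (ρ≗ (inj₂ x))
    ; (inj₂ x) → cong Sum.swap (ρ≗ (inj₁ x)) }

-- The positions are sorted by the summand in which `g` takes its value. Each block is itself some
-- `Fin`, so that its size can serve as the length of a word.
record Partition {A : Set a} {B : Set b} (g : Fin n → A ⊎ B) : Set (a ⊔ b) where
  field
    {size₁ size₂} : ℕ
    bijection     : (Fin size₁ ⊎ Fin size₂) ↔ Fin n
    label₁        : Fin size₁ → A
    label₂        : Fin size₂ → B
    labels        : ∀ s → g (to bijection s) ≡ Sum.map label₁ label₂ s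

open Partition

consˡ : (Fin k ⊎ Fin l) ↔ Fin n → (Fin (suc k) ⊎ Fin l) ↔ Fin (suc n)
consˡ {k} {l} {n} π = mk↔ₛ′ to′ from′ to∘from from∘to
  where
  to′ : Fin (suc k) ⊎ Fin l → Fin (suc n)
  to′ (inj₁ zero)    = zero
  to′ (inj₁ (suc i)) = suc (to π (inj₁ i))
  to′ (inj₂ j)       = suc (to π (inj₂ j))
  from′ : Fin (suc n) → Fin (suc k) ⊎ Fin l
  from′ zero    = inj₁ zero
  from′ (suc i) = Sum.map₁ suc (from π i)
  to∘map₁ : ∀ s → to′ (Sum.map₁ suc s) ≡ suc (to π s)
  to∘map₁ (inj₁ _) = refl
  to∘map₁ (inj₂ _) = refl
  to∘from : ∀ i → to′ (from′ i) ≡ i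
  to∘from zero    = refl
  to∘from (suc i) = trans (to∘map₁ (from π i)) (cong suc (strictlyInverseˡ π i))
  from∘to : ∀ s → from′ (to′ s) ≡ s
  from∘to (inj₁ zero)    = refl
  from∘to (inj₁ (suc i)) = cong (Sum.map₁ suc) (strictlyInverseʳ π (inj₁ i))
  from∘to (inj₂ j)       = cong (Sum.map₁ suc) (strictlyInverseʳ π (inj₂ j))

partition-consˡ : ∀ {g : Fin (suc n) → A ⊎ B} x → g zero ≡ inj₁ x → Partition (g ∘ suc) → Partition g
partition-consˡ x eq P .size₁ = suc (size₁ P)
partition-consˡ x eq P .size₂ = size₂ P
partition-consˡ x eq P .bijection = consˡ (bijection P)
partition-consˡ x eq P .label₁ zero    = x
partition-consˡ x eq P .label₁ (suc i) = label₁ P i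
partition-consˡ x eq P .label₂ = label₂ P
partition-consˡ x eq P .labels (inj₁ zero)    = eq
partition-consˡ x eq P .labels (inj₁ (suc i)) = labels P (inj₁ i)
partition-consˡ x eq P .labels (inj₂ j)       = labels P (inj₂ j)

partition-swap : ∀ {g : Fin n → A ⊎ B} → Partition (Sum.swap ∘ g) → Partition g
partition-swap P .size₁ = size₂ P
partition-swap P .size₂ = size₁ P
partition-swap P .bijection = bijection P ↔-∘ ⊎-comm _ _
partition-swap P .label₁ = label₂ P
partition-swap P .label₂ = label₁ P
partition-swap {g = g} P .labels s = to-injective (⊎-comm _ _)
  (trans (labels P (Sum.swap s)) (swapped s))
  where
  swapped : ∀ s → Sum.map (label₁ P) (label₂ P) (Sum.swap s) ≡ Sum.swap (Sum.map (label₂ P) (label₁ P) s)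
  swapped (inj₁ _) = refl
  swapped (inj₂ _) = refl

partition : (g : Fin n → A ⊎ B) → Partition g
partition {n = zero}  g = record
  { bijection = mk↔ₛ′ [ id , id ]′ inj₁ (λ ()) (λ { (inj₁ ()) ; (inj₂ ()) })
  ; label₁ = λ () ; label₂ = λ () ; labels = λ { (inj₁ ()) ; (inj₂ ()) } }
partition {n = suc n} g with g zero in eq
... | inj₁ x = partition-consˡ x eq (partition (g ∘ suc))
-- A head on the right is treated as a head on the left of the swapped function.
... | inj₂ y = partition-swap (partition-consˡ y (cong Sum.swap eq) (partition (Sum.swap ∘ g ∘ suc)))

-- Words in four blocks and the common refinement of two splittings.

+↔⊎² : ∀ x y z w → Fin ((x + y) + (z + w)) ↔ ((Fin x ⊎ Fin y) ⊎ (Fin z ⊎ Fin w))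
+↔⊎² _ _ _ _ = (+↔⊎ ⊎-↔ +↔⊎) ↔-∘ +↔⊎

-- The transposition of a two-by-two array of blocks: it turns the grouping by rows into the
-- grouping by columns.
middle : ∀ x y z w → Permutation ((x + z) + (y + w)) ((x + y) + (z + w))
middle x y z w = ↔-sym (+↔⊎² x y z w) ↔-∘ (interchange-↔ ↔-∘ +↔⊎² x z y w)

case² : ∀ {ℓ} {X : Set ℓ} → (A → X) → (B → X) → (C → X) → (D → X) → (A ⊎ B) ⊎ (C ⊎ D) → X
case² f g h k = [ [ f , g ]′ , [ h , k ]′ ]′

lookup-++² : ∀ {x y z w} (p : Vec A x) (q : Vec A y) (r : Vec A z) (s : Vec A w) t →
             lookup ((p ++ q) ++ (r ++ s)) (from (+↔⊎² x y z w) t) ≡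
             case² (lookup p) (lookup q) (lookup r) (lookup s) t
lookup-++² p q r s (inj₁ t) = trans (lookup-join (p ++ q) (r ++ s) (inj₁ _)) (lookup-join p q t)
lookup-++² p q r s (inj₂ t) = trans (lookup-join (p ++ q) (r ++ s) (inj₂ _)) (lookup-join r s t)

permute-middle : ∀ {x y z w} (p : Vec A x) (q : Vec A y) (r : Vec A z) (s : Vec A w) →
                 permute (middle x y z w) ((p ++ q) ++ (r ++ s)) ≡ (p ++ r) ++ (q ++ s)
permute-middle {x = x} {y} {z} {w} p q r s = permute-≡ (middle x y z w) ((p ++ q) ++ (r ++ s)) λ i → begin
  lookup ((p ++ q) ++ (r ++ s)) (middle x y z w ⟨$⟩ʳ i)
    ≡⟨ lookup-++² p q r s (interchange (to (+↔⊎² x z y w) i)) ⟩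
  case² (lookup p) (lookup q) (lookup r) (lookup s) (interchange (to (+↔⊎² x z y w) i))
    ≡⟨ swapped (to (+↔⊎² x z y w) i) ⟩
  case² (lookup p) (lookup r) (lookup q) (lookup s) (to (+↔⊎² x z y w) i)
    ≡⟨ lookup-++² p r q s (to (+↔⊎² x z y w) i) ⟨
  lookup ((p ++ r) ++ (q ++ s)) (from (+↔⊎² x z y w) (to (+↔⊎² x z y w) i))
    ≡⟨ cong (lookup ((p ++ r) ++ (q ++ s))) (strictlyInverseʳ (+↔⊎² x z y w) i) ⟩
  lookup ((p ++ r) ++ (q ++ s)) i ∎
  where
  open ≡-Reasoning
  swapped : ∀ t → case² (lookup p) (lookup q) (lookup r) (lookup s) (interchange t) ≡
                  case² (lookup p) (lookup r) (lookup q) (lookup s) t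
  swapped (inj₁ (inj₁ _)) = refl
  swapped (inj₁ (inj₂ _)) = refl
  swapped (inj₂ (inj₁ _)) = refl
  swapped (inj₂ (inj₂ _)) = refl

permute-injective : (σ : Permutation m n) {u v : Vec A n} → permute σ u ≡ permute σ v → u ≡ v
permute-injective σ {u} {v} eq =
  trans (sym (permute-flip σ u)) (trans (cong (permute (Perm.flip σ)) eq) (permute-flip σ v))

-- σ compares two splittings of the same positions, into a + b and into c + d; the blocks x, y, z, w
-- are the intersections of a with c, a with d, b with c and b with d.
record Grid (a b c d : ℕ) (σ : Permutation (c + d) (a + b)) : Set where
  field
    x y z w : ℕ
    αᵖ : Permutation (x + y) a
    βᵖ : Permutation (z + w) b
    γᵖ : Permutation (x + z) c
    δᵖ : Permutation (y + w) d
    square : ∀ i → ((γᵖ ⊕ δᵖ) ∘ₚ σ) ⟨$⟩ʳ i ≡ (middle x y z w ∘ₚ (αᵖ ⊕ βᵖ)) ⟨$⟩ʳ i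

-- The positions of `a`, and likewise those of `b`, are sorted by whether the inverse of `σ` sends
-- them to `c` or to `d`; this gives `αᵖ` and `βᵖ`. After interchanging the middle blocks, the whole
-- bijection respects the splitting into `c` and `d`, and its two restrictions give `γᵖ` and `δᵖ`.
grid : ∀ a b c d (σ : Permutation (c + d) (a + b)) → Grid a b c d σ
grid a b c d σ = record
  { x = x ; y = y ; z = z ; w = w
  ; αᵖ = α̂ ↔-∘ +↔⊎ ; βᵖ = β̂ ↔-∘ +↔⊎ ; γᵖ = γ̂ ↔-∘ +↔⊎ ; δᵖ = δ̂ ↔-∘ +↔⊎ ; square = square }
  where
  σ̂ : (Fin a ⊎ Fin b) ↔ (Fin c ⊎ Fin d)
  σ̂ = +↔⊎ ↔-∘ (Perm.flip σ ↔-∘ ↔-sym +↔⊎)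
  P = partition (to σ̂ ∘ inj₁)
  Q = partition (to σ̂ ∘ inj₂)
  x = size₁ P
  y = size₂ P
  z = size₁ Q
  w = size₂ Q
  α̂ : (Fin x ⊎ Fin y) ↔ Fin a
  α̂ = bijection P
  β̂ : (Fin z ⊎ Fin w) ↔ Fin b
  β̂ = bijection Q
  f : Fin x ⊎ Fin z → Fin c
  f = [ label₁ P , label₁ Q ]′
  g : Fin y ⊎ Fin w → Fin d
  g = [ label₂ P , label₂ Q ]′
  ρ : ((Fin x ⊎ Fin z) ⊎ (Fin y ⊎ Fin w)) ↔ (Fin c ⊎ Fin d)
  ρ = σ̂ ↔-∘ ((α̂ ⊎-↔ β̂) ↔-∘ interchange-↔)
  ρ≗ : ∀ s → to ρ s ≡ Sum.map f g s
  ρ≗ (inj₁ (inj₁ i)) = labels P (inj₁ i)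
  ρ≗ (inj₁ (inj₂ i)) = labels Q (inj₁ i)
  ρ≗ (inj₂ (inj₁ i)) = labels P (inj₂ i)
  ρ≗ (inj₂ (inj₂ i)) = labels Q (inj₂ i)
  γ̂ : (Fin x ⊎ Fin z) ↔ Fin c
  γ̂ = ↔-restrict₁ ρ ρ≗
  δ̂ : (Fin y ⊎ Fin w) ↔ Fin d
  δ̂ = ↔-restrict₂ ρ ρ≗
  open ≡-Reasoning
  E : Fin ((x + z) + (y + w)) ↔ ((Fin x ⊎ Fin z) ⊎ (Fin y ⊎ Fin w))
  E = +↔⊎² x z y w
  split² : ∀ t → to (+↔⊎² x y z w) (from (+↔⊎² x y z w) t) ≡ t
  split² = strictlyInverseˡ (+↔⊎² x y z w)
  square : ∀ i → (((γ̂ ↔-∘ +↔⊎) ⊕ (δ̂ ↔-∘ +↔⊎)) ∘ₚ σ) ⟨$⟩ʳ i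
               ≡ (middle x y z w ∘ₚ ((α̂ ↔-∘ +↔⊎) ⊕ (β̂ ↔-∘ +↔⊎))) ⟨$⟩ʳ i
  square i = begin
    to σ (join c d (Sum.map (f ∘ splitAt x) (g ∘ splitAt y) (splitAt (x + z) i)))
      ≡⟨ cong (to σ ∘ join c d) (map-map (splitAt (x + z) i)) ⟨
    to σ (join c d (Sum.map f g (to E i)))
      -- Unfolding `ρ` exposes an inverse of `σ`, which the outer `σ` cancels below.
      ≡⟨ cong (to σ ∘ join c d) (ρ≗ (to E i)) ⟨
    to σ (join c d (splitAt c (from σ (join a b (Sum.map (to α̂) (to β̂) (interchange (to E i)))))))
      ≡⟨ cong (to σ) (join-splitAt c d _) ⟩
    to σ (from σ (join a b (Sum.map (to α̂) (to β̂) (interchange (to E i)))))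
      ≡⟨ inverseʳ σ ⟩
    join a b (Sum.map (to α̂) (to β̂) (interchange (to E i)))
      ≡⟨ cong (join a b ∘ Sum.map (to α̂) (to β̂)) (split² (interchange (to E i))) ⟨
    join a b (Sum.map (to α̂) (to β̂) (to (+↔⊎² x y z w) (from (+↔⊎² x y z w) (interchange (to E i)))))
      ≡⟨ cong (join a b) (map-map (splitAt (x + y) (from (+↔⊎² x y z w) (interchange (to E i))))) ⟩
    join a b (Sum.map (to α̂ ∘ splitAt x) (to β̂ ∘ splitAt z)
      (splitAt (x + y) (from (+↔⊎² x y z w) (interchange (to E i))))) ∎

-- Factorizations of homogeneous sets and their refinement.

module _ {A : Set ℓ} where
  open Homogeneous

  -- This says that `R` is the product of its projections `left m n R` and `right m n R`. Only words
  -- are quantified over, never sets of words, so the condition stays in `Set ℓ`.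
  Rectangular : ∀ m n → Pred (Vec A (m + n)) ℓ → Set ℓ
  Rectangular m n R = ∀ (p p′ : Vec A m) (q q′ : Vec A n) → p ++ q′ ∈ R → p′ ++ q ∈ R → p ++ q ∈ R

  left : ∀ m n → Pred (Vec A (m + n)) ℓ → Pred (Vec A m) ℓ
  left m n R p = ∃[ q ] p ++ q ∈ R

  right : ∀ m n → Pred (Vec A (m + n)) ℓ → Pred (Vec A n) ℓ
  right m n R q = ∃[ p ] p ++ q ∈ R

  left-nonempty : ∀ m n {R : Pred (Vec A (m + n)) ℓ} → Satisfiable R → Satisfiable (left m n R)
  left-nonempty m n (v , v∈R) with p , q , refl ← splitAtᵛ m v = p , q , v∈R

  right-nonempty : ∀ m n {R : Pred (Vec A (m + n)) ℓ} → Satisfiable R → Satisfiable (right m n R)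
  right-nonempty m n (v , v∈R) with p , q , refl ← splitAtᵛ m v = q , p , v∈R

  ·-nonempty : (σ : Permutation m n) {S : Pred (Vec A n) ℓ} → Satisfiable S → Satisfiable (σ · S)
  ·-nonempty σ (w , w∈S) = permute σ w , w , w∈S , refl

  leftFactor : ∀ m n (H : Homogeneous A) → Permutation (m + n) (dim H) → Homogeneous A
  leftFactor m n H π =
    homogeneous (left m n (π · words H)) (left-nonempty m n (·-nonempty π (nonempty H)))

  rightFactor : ∀ m n (H : Homogeneous A) → Permutation (m + n) (dim H) → Homogeneous A
  rightFactor m n H π =
    homogeneous (right m n (π · words H)) (right-nonempty m n (·-nonempty π (nonempty H)))

  -- Every word of length `dim K + dim L` is a concatenation, so membership need only be compared on
  -- words already cut in two.
  ∼-⊛ : ∀ (H K L : Homogeneous A) (π : Permutation (dim K + dim L) (dim H)) →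
        (∀ p q → p ++ q ∈ π · words H → p ∈ words K × q ∈ words L) →
        (∀ p q → p ∈ words K → q ∈ words L → p ++ q ∈ π · words H) →
        H ∼ K ⊛ L
  ∼-⊛ H K L π split glue = π , (λ { (p , q , p∈K , q∈L , refl) → glue p q p∈K q∈L }) , back
    where
    back : ∀ {v} → v ∈ π · words H → v ∈ words K ∗ words L
    back {v} v∈ with p , q , refl ← splitAtᵛ (dim K) v
                with p∈K , q∈L ← split p q v∈ = p , q , p∈K , q∈L , refl

  rectangular⇒∼-⊛ : ∀ m n (H : Homogeneous A) (π : Permutation (m + n) (dim H)) →
                    Rectangular m n (π · words H) →
                    H ∼ leftFactor m n H π ⊛ rightFactor m n H π
  rectangular⇒∼-⊛ m n H π rect = ∼-⊛ H (leftFactor m n H π) (rightFactor m n H π) π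
    (λ p q pq∈ → (q , pq∈) , (p , pq∈))
    (λ { p q (q′ , pq′∈) (p′ , p′q∈) → rect p p′ q q′ pq′∈ p′q∈ })

  -- A word can be cut at a given length in only one way, so the halves of words of a product lie in
  -- the respective factors and may be recombined.
  ∼-⊛⇒rectangular : ∀ (H K L : Homogeneous A) (H∼K⊛L : H ∼ K ⊛ L) →
                    Rectangular (dim K) (dim L) (proj₁ H∼K⊛L · words H)
  ∼-⊛⇒rectangular H K L (π , KL⊆πH , πH⊆KL) p p′ q q′ pq′∈ p′q∈
    with u , _ , u∈K , _ , eq ← πH⊆KL pq′∈ | u′ , v , _ , v∈L , eq′ ← πH⊆KL p′q∈
    with refl , _ ← ++-injective p u eq | _ , refl ← ++-injective p′ u′ eq′ =
    KL⊆πH (p , v , u∈K , v∈L , refl)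

  -- The factors are the projections of `H` and `K` to the four blocks of the grid. `toLM` and
  -- `fromLM` show that a word in four blocks has its rows in `H` and `K` exactly when it has its
  -- columns in `L` and `M`, up to the permutations of the grid.
  ⊛-refinement : ∀ (H K L M : Homogeneous A) → H ⊛ K ∼ L ⊛ M → ∃₂ λ X Y → ∃₂ λ Z W →
                 (H ∼ X ⊛ Y × K ∼ Z ⊛ W) × (L ∼ X ⊛ Z × M ∼ Y ⊛ W)
  ⊛-refinement H K L M (σ , LM⊆σHK , σHK⊆LM) =
    X , Y , Z , W
    , ( ∼-⊛ H X Y αᵖ (λ p q pq∈ → (q , pq∈) , (p , pq∈))
          (λ { p q (q′ , pq′∈) (p′ , p′q∈) →
               -- Both words are completed by the same row of `K`. Columns may be chosen
               -- independently, so the first column of one and the second column of the other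
               -- combine to a word whose first row is `p ++ q`.
               let pr∈ , _ = toLM p q′ r₀ s₀ pq′∈ r₀s₀∈
                   _ , qs∈ = toLM p′ q r₀ s₀ p′q∈ r₀s₀∈
               in proj₁ (fromLM p q r₀ s₀ pr∈ qs∈) })
      , ∼-⊛ K Z W βᵖ (λ r s rs∈ → (s , rs∈) , (r , rs∈))
          (λ { r s (s′ , rs′∈) (r′ , r′s∈) →
               let pr∈ , _ = toLM p₀ q₀ r s′ p₀q₀∈ rs′∈
                   _ , qs∈ = toLM p₀ q₀ r′ s p₀q₀∈ r′s∈
               in proj₂ (fromLM p₀ q₀ r s pr∈ qs∈) }))
    , ( ∼-⊛ L X Z γᵖ
          -- The fixed column of `M` fills in the missing blocks, and the rows of the completed word
          -- witness both projections.
          (λ p r pr∈ → let pq∈ , rs∈ = fromLM p q₀ r s₀ pr∈ q₀s₀∈ in (q₀ , pq∈) , (s₀ , rs∈))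
          (λ { p r (q , pq∈) (s , rs∈) → proj₁ (toLM p q r s pq∈ rs∈) })
      , ∼-⊛ M Y W δᵖ
          (λ q s qs∈ → let pq∈ , rs∈ = fromLM p₀ q r₀ s p₀r₀∈ qs∈ in (p₀ , pq∈) , (r₀ , rs∈))
          (λ { q s (p , pq∈) (r , rs∈) → proj₂ (toLM p q r s pq∈ rs∈) }))
    where
    open Grid (grid (dim H) (dim K) (dim L) (dim M) σ)
    open ≡-Reasoning

    -- The equation `square` of the grid, transported from positions to words.
    regroup : ∀ u v g h → g ++ h ≡ permute σ (u ++ v) →
              permute γᵖ g ++ permute δᵖ h ≡ permute (middle x y z w) (permute αᵖ u ++ permute βᵖ v)
    regroup u v g h eq = begin
      permute γᵖ g ++ permute δᵖ h                  ≡⟨ permute-⊕ γᵖ δᵖ g h ⟨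
      permute (γᵖ ⊕ δᵖ) (g ++ h)                    ≡⟨ cong (permute (γᵖ ⊕ δᵖ)) eq ⟩
      permute (γᵖ ⊕ δᵖ) (permute σ (u ++ v))        ≡⟨ permute-∘ (γᵖ ⊕ δᵖ) σ (u ++ v) ⟩
      permute ((γᵖ ⊕ δᵖ) ∘ₚ σ) (u ++ v)             ≡⟨ tabulate-cong (cong (lookup (u ++ v)) ∘ square) ⟩
      permute (middle x y z w ∘ₚ (αᵖ ⊕ βᵖ)) (u ++ v) ≡⟨ permute-∘ (middle x y z w) (αᵖ ⊕ βᵖ) (u ++ v) ⟨
      permute (middle x y z w) (permute (αᵖ ⊕ βᵖ) (u ++ v))
        ≡⟨ cong (permute (middle x y z w)) (permute-⊕ αᵖ βᵖ u v) ⟩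
      permute (middle x y z w) (permute αᵖ u ++ permute βᵖ v) ∎

    toLM : ∀ (p : Vec A x) (q : Vec A y) (r : Vec A z) (s : Vec A w) →
           p ++ q ∈ αᵖ · words H → r ++ s ∈ βᵖ · words K →
           p ++ r ∈ γᵖ · words L × q ++ s ∈ δᵖ · words M
    toLM p q r s (u , u∈H , pq≡) (v , v∈K , rs≡)
      with g , h , g∈L , h∈M , eq ← σHK⊆LM (u ++ v , (u , v , u∈H , v∈K , refl) , refl) =
      (g , g∈L , proj₁ both) , (h , h∈M , proj₂ both)
      where
      both : (p ++ r ≡ permute γᵖ g) × (q ++ s ≡ permute δᵖ h)
      both = ++-injective (p ++ r) (permute γᵖ g) (begin
        (p ++ r) ++ (q ++ s)                                     ≡⟨ permute-middle p q r s ⟨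
        permute (middle x y z w) ((p ++ q) ++ (r ++ s))
          ≡⟨ cong (permute (middle x y z w)) (cong₂ _++_ pq≡ rs≡) ⟩
        permute (middle x y z w) (permute αᵖ u ++ permute βᵖ v)  ≡⟨ regroup u v g h (sym eq) ⟨
        permute γᵖ g ++ permute δᵖ h                             ∎)

    fromLM : ∀ (p : Vec A x) (q : Vec A y) (r : Vec A z) (s : Vec A w) →
             p ++ r ∈ γᵖ · words L → q ++ s ∈ δᵖ · words M →
             p ++ q ∈ αᵖ · words H × r ++ s ∈ βᵖ · words K
    fromLM p q r s (g , g∈L , pr≡) (h , h∈M , qs≡)
      with _ , (u , v , u∈H , v∈K , refl) , eq ← LM⊆σHK (g , h , g∈L , h∈M , refl) =
      (u , u∈H , proj₁ both) , (v , v∈K , proj₂ both)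
      where
      both : (p ++ q ≡ permute αᵖ u) × (r ++ s ≡ permute βᵖ v)
      both = ++-injective (p ++ q) (permute αᵖ u) (permute-injective (middle x y z w) (begin
        permute (middle x y z w) ((p ++ q) ++ (r ++ s))          ≡⟨ permute-middle p q r s ⟩
        (p ++ r) ++ (q ++ s)                                     ≡⟨ cong₂ _++_ pr≡ qs≡ ⟩
        permute γᵖ g ++ permute δᵖ h                             ≡⟨ regroup u v g h eq ⟩
        permute (middle x y z w) (permute αᵖ u ++ permute βᵖ v)  ∎))

    X Y Z W : Homogeneous A
    X = leftFactor x y H αᵖ
    Y = rightFactor x y H αᵖ
    Z = leftFactor z w K βᵖ
    W = rightFactor z w K βᵖ

    -- One word in four blocks is fixed; its pieces serve as fillers wherever only one row or column
    -- is given.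
    p₀ = proj₁ (nonempty X)
    q₀ = proj₁ (proj₂ (nonempty X))
    p₀q₀∈ = proj₂ (proj₂ (nonempty X))
    r₀ = proj₁ (nonempty Z)
    s₀ = proj₁ (proj₂ (nonempty Z))
    r₀s₀∈ = proj₂ (proj₂ (nonempty Z))
    p₀r₀∈ = proj₁ (toLM p₀ q₀ r₀ s₀ p₀q₀∈ r₀s₀∈)
    q₀s₀∈ = proj₂ (toLM p₀ q₀ r₀ s₀ p₀q₀∈ r₀s₀∈)

  -- Units, irreducibles and existence of factorizations.

  dim≡0⇒∼𝟙 : ∀ (H : Homogeneous A) → dim H ≡ 0 → H ∼ 𝟙
  dim≡0⇒∼𝟙 H@(homogeneous _ ([] , []∈H)) refl =
    Perm.id , (λ { refl → [] , []∈H , refl }) , λ { {[]} _ → refl }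

  ∼𝟙⇒dim≡0 : ∀ (H : Homogeneous A) → H ∼ 𝟙 → dim H ≡ 0
  ∼𝟙⇒dim≡0 H = ∼⇒dim≡ H 𝟙

  -- Dimensions add, and a nonempty set in dimension zero consists of the empty word alone.
  ⊛-conical : ∀ (H K : Homogeneous A) → H ⊛ K ∼ 𝟙 → H ∼ 𝟙
  ⊛-conical H K HK∼𝟙 = dim≡0⇒∼𝟙 H (ℕ.m+n≡0⇒m≡0 (dim H) (∼⇒dim≡ (H ⊛ K) 𝟙 HK∼𝟙))

  -- Irreducibility quantifies over all homogeneous sets and so lives one universe above the excluded
  -- middle at hand; this reformulation of reducibility does not.
  Splittable : Homogeneous A → Set ℓ
  Splittable H = ∃₂ λ m n → Σ (Permutation (suc m + suc n) (dim H)) λ π →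
                 Rectangular (suc m) (suc n) (π · words H)

  module _ (em : ExcludedMiddle ℓ) where
    private
      𝓜 = homogeneousMonoid A
    open CommutativeMonoid 𝓜 using (setoid)
    open Relation.Binary.Reasoning.Setoid setoid
    open IrreducibleFactorization 𝓜 (λ _ _ → em) using (product; product-++)

    -- A factor of dimension zero is a unit, while two factors of positive dimension would split
    -- `H`.
    ¬splittable⇒irreducible : ∀ (H : Homogeneous A) → ¬ dim H ≡ 0 → ¬ Splittable H →
                              IsIrreducible 𝓜 H
    ¬splittable⇒irreducible H dim≢0 ¬splittable = record
      { nonUnit = λ u → dim≢0 (∼𝟙⇒dim≡0 H (conical⇒unit≈ε 𝓜 (λ {K} {L} → ⊛-conical K L) H u))
      ; split   = λ {K} {L} → split K L
      }
      where
      split : ∀ (K L : Homogeneous A) → H ∼ K ⊛ L → IsUnit 𝓜 K ⊎ IsUnit 𝓜 L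
      split K@(homogeneous {zero} _ _) L _ = inj₁ (≈ε⇒unit 𝓜 K (dim≡0⇒∼𝟙 K refl))
      split K@(homogeneous {suc _} _ _) L@(homogeneous {zero} _ _) _ = inj₂ (≈ε⇒unit 𝓜 L (dim≡0⇒∼𝟙 L refl))
      split K@(homogeneous {suc _} _ _) L@(homogeneous {suc _} _ _) H∼KL =
        contradiction (_ , _ , proj₁ H∼KL , ∼-⊛⇒rectangular H K L H∼KL) ¬splittable

    ⊛-atomic : ∀ N (H : Homogeneous A) → dim H ≤ N → ∃[ xs ] H ∼ product xs
    ⊛-atomic N H dim≤N with dim H ℕ.≟ 0
    ... | yes dim≡0 = [] , dim≡0⇒∼𝟙 H dim≡0
    ⊛-atomic zero    H dim≤N | no dim≢0 = contradiction (ℕ.n≤0⇒n≡0 dim≤N) dim≢0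
    ⊛-atomic (suc N) H dim≤N | no dim≢0 with em {Splittable H}
    ... | no ¬splittable =
      (H , ¬splittable⇒irreducible H dim≢0 ¬splittable) ∷ [] , ∼-sym {H = H ⊛ 𝟙} {H} (⊛-identityʳ H)
    ... | yes (m , n , π , rect)
      -- `size` states `suc (m + n) ≤ N`. Each factor leaves at least one position to the other, so
      -- both dimensions `suc m` and `suc n` are at most `N`.
      with size ← s≤s⁻¹ (ℕ.≤-trans (ℕ.≤-reflexive (trans (sym (ℕ.+-suc (suc m) n)) (↔⇒≡ π))) dim≤N)
      with xs , K∼ ← ⊛-atomic N (leftFactor (suc m) (suc n) H π) (ℕ.≤-trans (s≤s (ℕ.m≤m+n m n)) size)
         | ys , L∼ ← ⊛-atomic N (rightFactor (suc m) (suc n) H π) (ℕ.≤-trans (s≤s (ℕ.m≤n+m n m)) size) =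
      xs ++ₗ ys
      , (begin
          H                        ≈⟨ rectangular⇒∼-⊛ (suc m) (suc n) H π rect ⟩
          K ⊛ L                    ≈⟨ ⊛-cong {H = K} {product xs} {L} {product ys} K∼ L∼ ⟩
          product xs ⊛ product ys  ≈⟨ product-++ xs ys ⟨
          product (xs ++ₗ ys)      ∎)
      where
      K L : Homogeneous A
      K = leftFactor (suc m) (suc n) H π
      L = rightFactor (suc m) (suc n) H π

theorem1 : ∀ {a : Level} (em : ExcludedMiddle a) (A : Set a) → IsFree (homogeneousMonoid A) (λ _ _ → em)
theorem1 em A = isFree
  (λ {H} {K} → ⊛-conical H K)
  (λ {H} {K} {L} {M} → ⊛-refinement H K L M)
  (λ H → ⊛-atomic em (Homogeneous.dim H) H ℕ.≤-refl)
  where open IrreducibleFactorization (homogeneousMonoid A) (λ _ _ → em)
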